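{- Every finite poset $(P,>)$ has a cut $(B,U)$ with $$e(B,U)\ \ge\ \frac{e(P,P)}{2}.$$ The bound is tight up to lower-order terms: there is a sequence of finite posets $P_n$ with $e(P_n,P_n)\to\infty$ such that $\max_{(B,U)} e(B,U) = \frac{1+o_n(1)}{2}\, e(P_n,P_n)$ as $n\to\infty$, where the maximum is over all cuts $(B,U)$ of $P_n$. Moreover, there is an algorithm that, given a finite poset $(P,>)$, finds a cut $(B,U)$ with $e(B,U)\ge e(P,P)/2$ in time $O(|(P,>)|)$.
   Context: $(P,>)$ is a finite partially ordered set with strict order relation. For subsets $X,Y\subseteq P$ (not necessarily disjoint), $E(X,Y):=\{(x,y) : x\in X,\ y\in Y,\ x<y\}$ and $e(X,Y):=|E(X,Y)|$; in particular $e(P,P)$ is the number of pairs $(x,y)$ with $x<y$ in $P$. A cut in $(P,>)$ is an ordered partition $(B,U)$ of the set $P$, i.e. $B\cup U=P$ and $B\cap U=\emptyset$ (a part may be empty); its size is $e(B,U)$. $|(P,>)|$ denotes the size of the input poset, given as the list of its elements together with the list of all pairs $x<y$, i.e. $|P|+e(P,P)$; running time is counted in elementary operations in the standard unit-cost RAM model. -}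

module Defs where

open import Data.Bool.Base using (if_then_else_)
open import Data.Fin.Base using (Fin; toℕ)
open import Data.Fin.Subset using (Subset; _∈_; _∪_; _∩_; ⊤; ⊥)
open import Data.Fin.Subset.Properties using (_∈?_)
open import Data.Integer.Base using (+_)
open import Data.List.Base
  using (List; []; _∷_; _++_; length; map; concatMap; filter; cartesianProduct; allFin)
open import Data.List.Relation.Binary.Permutation.Propositional using (_↭_)
open import Data.Maybe.Base using (Maybe; just; nothing; maybe′)
open import Data.Nat.Base using (ℕ; zero; suc; _+_; _*_; _∸_; _≤_; _≡ᵇ_)
open import Data.Nat.GeneralisedArithmetic using (iterate)
open import Data.Product.Base using (_×_; _,_; ∃-syntax)
open import Data.Rational.Base as ℚ using (ℚ)
open import Level using (0ℓ)
open import Relation.Binary.Core using (Rel)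
open import Relation.Binary.PropositionalEquality.Core using (_≡_)
open import Relation.Binary.Structures using (IsDecStrictPartialOrder)
open import Relation.Nullary.Decidable.Core using (_×-dec_)

------------------------------------------------------------------------
-- Finite posets and cuts

-- The order is decidable so that pairs can be counted constructively.
record FinPoset : Set₁ where
  infix 4 _≺_
  field
    size                    : ℕ
    _≺_                     : Rel (Fin size) 0ℓ
    isDecStrictPartialOrder : IsDecStrictPartialOrder _≡_ _≺_

  open IsDecStrictPartialOrder isDecStrictPartialOrder public
    renaming (_<?_ to _≺?_)

module _ (P : FinPoset) where
  open FinPoset P

  E : Subset size → Subset size → List (Fin size × Fin size)
  E X Y = filter (λ (x , y) → (x ∈? X) ×-dec (y ∈? Y) ×-dec (x ≺? y))
                 (cartesianProduct (allFin size) (allFin size))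

  e : Subset size → Subset size → ℕ
  e X Y = length (E X Y)

  ePP : ℕ
  ePP = e ⊤ ⊤

  record Cut : Set where
    field
      B U      : Subset size
      covers   : B ∪ U ≡ ⊤
      disjoint : B ∩ U ≡ ⊥

  cutSize : Cut → ℕ
  cutSize C = e (Cut.B C) (Cut.U C)

  IsMaxCutSize : ℕ → Set
  IsMaxCutSize m = (∃[ C ] cutSize C ≡ m) × (∀ C → cutSize C ≤ m)

  inputSize : ℕ
  inputSize = size + ePP

------------------------------------------------------------------------
-- Limits of sequences

TendsToInfinity : (ℕ → ℕ) → Set
TendsToInfinity a = ∀ K → ∃[ N ] (∀ n → N ≤ n → K ≤ a n)

TendsToZero : (ℕ → ℚ) → Set
TendsToZero ε = ∀ δ → ℚ.0ℚ ℚ.< δ → ∃[ N ] (∀ n → N ≤ n → ℚ.∣ ε n ∣ ℚ.< δ)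

fromℕ : ℕ → ℚ
fromℕ n = + n ℚ./ 1

------------------------------------------------------------------------
-- Unit-cost random access machines

-- Registers, memory cells and program positions are all numbered by ℕ, and
-- registers and cells hold natural numbers.  Only `load` and `store` access
-- the memory; they take the address from a register.  `sub` is truncated
-- subtraction.
data Instr : Set where
  const     : (dst value : ℕ) → Instr
  add sub   : (dst src₁ src₂ : ℕ) → Instr
  load      : (dst addr : ℕ) → Instr
  store     : (addr src : ℕ) → Instr
  jump      : (target : ℕ) → Instr
  jumpIf0   : (src target : ℕ) → Instr

Program : Set
Program = List Instr

record State : Set where
  constructor ⟨_,_,_⟩
  field
    pc   : ℕ
    regs : ℕ → ℕ
    mem  : ℕ → ℕ

infixl 9 _[_≔_]
_[_≔_] : (ℕ → ℕ) → ℕ → ℕ → (ℕ → ℕ)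
(f [ i ≔ v ]) j = if i ≡ᵇ j then v else f j

execute : Instr → State → State
execute (const d k)   ⟨ p , r , m ⟩ = ⟨ suc p , r [ d ≔ k ] , m ⟩
execute (add d a b)   ⟨ p , r , m ⟩ = ⟨ suc p , r [ d ≔ r a + r b ] , m ⟩
execute (sub d a b)   ⟨ p , r , m ⟩ = ⟨ suc p , r [ d ≔ r a ∸ r b ] , m ⟩
execute (load d a)    ⟨ p , r , m ⟩ = ⟨ suc p , r [ d ≔ m (r a) ] , m ⟩
execute (store a s)   ⟨ p , r , m ⟩ = ⟨ suc p , r , m [ r a ≔ r s ] ⟩
execute (jump l)      ⟨ p , r , m ⟩ = ⟨ l , r , m ⟩
execute (jumpIf0 s l) ⟨ p , r , m ⟩ = ⟨ (if r s ≡ᵇ 0 then l else suc p) , r , m ⟩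

fetch : Program → ℕ → Maybe Instr
fetch []       _       = nothing
fetch (i ∷ _)  zero    = just i
fetch (_ ∷ is) (suc p) = fetch is p

-- The machine halts by leaving the program; a halted machine stays put.
Halted : Program → State → Set
Halted prog s = fetch prog (State.pc s) ≡ nothing

step : Program → State → State
step prog s = maybe′ (λ i → execute i s) s (fetch prog (State.pc s))

run : Program → ℕ → State → State
run prog t s = iterate (step prog) s t

memory : List ℕ → ℕ → ℕ
memory []       _       = 0
memory (v ∷ _)  zero    = v
memory (_ ∷ vs) (suc a) = memory vs a

start : List ℕ → State
start input = ⟨ 0 , (λ _ → 0) , memory input ⟩

------------------------------------------------------------------------
-- Posets as inputs, cuts as outputs

-- Both lists may come in any order.
record Listing (P : FinPoset) : Set where
  open FinPoset P
  field
    elements    : List (Fin size)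
    elements-↭  : elements ↭ allFin size
    pairs       : List (Fin size × Fin size)
    pairs-↭     : pairs ↭ E P ⊤ ⊤

-- The lengths of the two lists, then the elements, then the pairs, each
-- pair x ≺ y in two consecutive cells.
encode : {P : FinPoset} → Listing P → List ℕ
encode L = length elements ∷ length pairs ∷
           map toℕ elements ++ concatMap (λ (x , y) → toℕ x ∷ toℕ y ∷ []) pairs
  where open Listing L

-- A cut is output as the characteristic vector of B, in the cells 0, …, |P| - 1.
Outputs : {P : FinPoset} → State → Cut P → Set
Outputs s C = ∀ x → (x ∈ Cut.B C → State.mem s (toℕ x) ≡ 1)
                  × (x ∈ Cut.U C → State.mem s (toℕ x) ≡ 0)

-- `1 +` provides for the empty poset, on which linear time means constant time.
FindsCutInLinearTime : ((P : FinPoset) → Cut P → Set) → Program → Set₁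
FindsCutInLinearTime Good prog =
  ∃[ c ] (∀ P (L : Listing P) →
    ∃[ t ] t ≤ c * (1 + inputSize P) ×
           Halted prog (run prog t (start (encode L))) ×
           (∃[ C ] Outputs (run prog t (start (encode L))) C × Good P C))

{-# OPTIONS --safe #-}

-- Write u(x) and d(x) for the numbers of elements above and below x, and put
-- B = {d ≤ u}, U = {u < d}.  Every pair x < y outside E(B, U) has y ∈ B or
-- x ∈ U, so e(P, P) ≤ e(B, U) + Σ_B d + Σ_U u = e(B, U) + Σ min(u, d), and it
-- suffices that 2 Σ min(u, d) ≤ e(P, P).  This follows by induction: deleting a
-- maximal element v of B changes no other minimum, so it lowers the left side by
-- 2 d(v) and the right side by d(v) + u(v).  The degrees, hence the cut, are
-- computed in one pass over the list of pairs.  For tightness, a chain of 2k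
-- elements has k(2k − 1) pairs, and a cut contains at most |B| |U| ≤ k² of them.
module Submission where

open import Defs
open import Data.Bool.Base using (if_then_else_)
open import Data.Fin.Base as Fin using (Fin; zero; suc; toℕ)
import Data.Fin.Properties as Fin
open import Data.Fin.Subset using (Subset; _∈_; ∁; ⊤)
open import Data.Fin.Subset.Properties using (_∈?_; ∈⊤; ∉⊥; p∪∁p≡⊤; ∩-inverseʳ; x∈p∩q⁺)
open import Data.Fin.Subset.Properties using (x∈∁p⇒x∉p; x∉p⇒x∈∁p)
open import Data.Integer.Base as ℤ using ()
import Data.Integer.Properties as ℤ
open import Data.List.Base using (List; []; _∷_; _++_; length; map)
open import Data.List.Base using (concatMap; filter; cartesianProduct; allFin)
open import Data.List.Properties using (length-++; length-map; length-tabulate; map-++; map-tabulate; map-∘)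
open import Data.List.Relation.Binary.Permutation.Propositional using (_↭_; prep; swap; ↭-refl; ↭-trans)
open import Data.List.Relation.Binary.Permutation.Propositional.Properties using (map⁺; ↭-length)
open import Data.List.Relation.Unary.All as All using (All; []; _∷_)
open import Data.Maybe.Base using (just)
open import Data.Nat.Base
open import Data.Nat.Coprimality using (1-coprimeTo)
open import Data.Nat.ListAction using (sum)
open import Data.Nat.ListAction.Properties using (sum-↭; sum-++)
open import Data.Nat.Properties
open import Data.Nat.Tactic.RingSolver using (solve-∀)
open import Data.Product.Base using (_×_; _,_; Σ-syntax; ∃-syntax; proj₁; proj₂)
open import Data.Rational.Base as ℚ using (ℚ; mkℚ; 1ℚ; ½; toℚᵘ)
import Data.Rational.Properties as ℚ
open import Data.Rational.Unnormalised.Base as ℚᵘ using (mkℚᵘ; *≡*)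
import Data.Rational.Unnormalised.Properties as ℚᵘ
open import Data.Sum.Base using (_⊎_; inj₁; inj₂)
open import Data.Unit.Base using (tt) renaming (⊤ to Unit)
import Data.Vec.Base as Vec
open import Data.Vec.Properties using (lookup∘tabulate; []=⇒lookup; lookup⇒[]=)
open import Function.Base using (_∘_; id)
open import Level using (0ℓ)
open import Relation.Binary.Core using (Rel)
open import Relation.Binary.Definitions using (tri<; tri≈; tri>)
open import Relation.Binary.PropositionalEquality
open import Relation.Binary.Structures using (IsDecStrictPartialOrder)
open import Relation.Nullary.Decidable using (Dec; yes; no; does; _×-dec_)
open import Relation.Nullary.Decidable using (decidable-stable; dec-true; dec-false)
open import Relation.Nullary.Negation.Core using (¬_; contradiction)
open import Relation.Unary using (Decidable)

-- Indicators and finite sums over lists.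

⟦_⟧ : {A : Set} → Dec A → ℕ
⟦ A? ⟧ = if does A? then 1 else 0

⟦⟧-true : {A : Set} (A? : Dec A) → A → ⟦ A? ⟧ ≡ 1
⟦⟧-true A? a rewrite dec-true A? a = refl

⟦⟧-false : {A : Set} (A? : Dec A) → ¬ A → ⟦ A? ⟧ ≡ 0
⟦⟧-false A? ¬a rewrite dec-false A? ¬a = refl

⟦⟧-mono : {A B : Set} (A? : Dec A) (B? : Dec B) → (A → B) → ⟦ A? ⟧ ≤ ⟦ B? ⟧
⟦⟧-mono (yes a) B? f = ≤-reflexive (sym (⟦⟧-true B? (f a)))
⟦⟧-mono (no _)  B? f = z≤n

⟦⟧-cong : {A B : Set} (A? : Dec A) (B? : Dec B) → (A → B) → (B → A) → ⟦ A? ⟧ ≡ ⟦ B? ⟧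
⟦⟧-cong A? B? f g = ≤-antisym (⟦⟧-mono A? B? f) (⟦⟧-mono B? A? g)

⟦⟧-× : {A B : Set} (A? : Dec A) (B? : Dec B) → ⟦ A? ×-dec B? ⟧ ≡ ⟦ A? ⟧ * ⟦ B? ⟧
⟦⟧-× (yes _) (yes _) = refl
⟦⟧-× (yes _) (no _)  = refl
⟦⟧-× (no _)  _       = refl

∑ : {A : Set} → List A → (A → ℕ) → ℕ
∑ xs f = sum (map f xs)

infix 5 ∑
syntax ∑ xs (λ x → e) = ∑[ x ← xs ] e

∑-cong-All : {A : Set} {f g : A → ℕ} {xs : List A} →
             All (λ x → f x ≡ g x) xs → ∑ xs f ≡ ∑ xs g
∑-cong-All []       = refl
∑-cong-All (p ∷ ps) = cong₂ _+_ p (∑-cong-All ps)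

∑-cong : {A : Set} {f g : A → ℕ} (xs : List A) → (∀ x → f x ≡ g x) → ∑ xs f ≡ ∑ xs g
∑-cong xs p = ∑-cong-All (All.universal p xs)

∑-mono : {A : Set} {f g : A → ℕ} (xs : List A) → (∀ x → f x ≤ g x) → ∑ xs f ≤ ∑ xs g
∑-mono []       p = z≤n
∑-mono (x ∷ xs) p = +-mono-≤ (p x) (∑-mono xs p)

∑-mono-< : {A : Set} {f g : A → ℕ} {x : A} {xs : List A} →
           All (λ y → f y < g y) (x ∷ xs) → ∑ (x ∷ xs) f < ∑ (x ∷ xs) g
∑-mono-< (p ∷ [])         = +-mono-<-≤ p z≤n
∑-mono-< (p ∷ ps@(_ ∷ _)) = +-mono-< p (∑-mono-< ps)

∑-+ : {A : Set} (f g : A → ℕ) (xs : List A) → ∑[ x ← xs ] (f x + g x) ≡ ∑ xs f + ∑ xs g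
∑-+ f g []       = refl
∑-+ f g (x ∷ xs) = trans (cong (f x + g x +_) (∑-+ f g xs)) (interchange (f x) (g x) _ _)
  where
  interchange : ∀ a b c d → (a + b) + (c + d) ≡ (a + c) + (b + d)
  interchange = solve-∀

∑-*ˡ : {A : Set} (c : ℕ) (f : A → ℕ) (xs : List A) → ∑[ x ← xs ] (c * f x) ≡ c * ∑ xs f
∑-*ˡ c f []       = sym (*-zeroʳ c)
∑-*ˡ c f (x ∷ xs) = trans (cong (c * f x +_) (∑-*ˡ c f xs)) (sym (*-distribˡ-+ c (f x) _))

∑-*ʳ : {A : Set} (f : A → ℕ) (c : ℕ) (xs : List A) → ∑[ x ← xs ] (f x * c) ≡ ∑ xs f * c
∑-*ʳ f c []       = refl
∑-*ʳ f c (x ∷ xs) = trans (cong (f x * c +_) (∑-*ʳ f c xs)) (sym (*-distribʳ-+ c (f x) _))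

∑-zero : {A : Set} (xs : List A) → ∑[ x ← xs ] 0 ≡ 0
∑-zero []       = refl
∑-zero (_ ∷ xs) = ∑-zero xs

∑-swap : {A B : Set} (f : A → B → ℕ) (xs : List A) (ys : List B) →
         ∑[ x ← xs ] ∑[ y ← ys ] f x y ≡ ∑[ y ← ys ] ∑[ x ← xs ] f x y
∑-swap f []       ys = sym (∑-zero ys)
∑-swap f (x ∷ xs) ys = trans (cong (∑ ys (f x) +_) (∑-swap f xs ys)) (sym (∑-+ (f x) _ ys))

∑-↭ : {A : Set} (f : A → ℕ) {xs ys : List A} → xs ↭ ys → ∑ xs f ≡ ∑ ys f
∑-↭ f p = sum-↭ (map⁺ f p)

∑-++ : {A : Set} (f : A → ℕ) (xs ys : List A) → ∑ (xs ++ ys) f ≡ ∑ xs f + ∑ ys f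
∑-++ f xs ys = trans (cong sum (map-++ f xs ys)) (sum-++ (map f xs) (map f ys))

∑-map : {A B : Set} (f : B → ℕ) (g : A → B) (xs : List A) →
        ∑ (map g xs) f ≡ ∑[ x ← xs ] f (g x)
∑-map f g xs = cong sum (sym (map-∘ xs))

∑-filter : {A : Set} {P : A → Set} (P? : Decidable P) (f : A → ℕ) (xs : List A) →
           ∑ (filter P? xs) f ≡ ∑[ x ← xs ] ⟦ P? x ⟧ * f x
∑-filter P? f []       = refl
∑-filter P? f (x ∷ xs) with P? x
... | yes _ = cong₂ _+_ (sym (*-identityˡ (f x))) (∑-filter P? f xs)
... | no _  = ∑-filter P? f xs

length-filter : {A : Set} {P : A → Set} (P? : Decidable P) (xs : List A) →
                length (filter P? xs) ≡ ∑[ x ← xs ] ⟦ P? x ⟧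
length-filter P? []       = refl
length-filter P? (x ∷ xs) with P? x
... | yes _ = cong suc (length-filter P? xs)
... | no _  = length-filter P? xs

∑-cartesianProduct : {A B : Set} (f : A × B → ℕ) (xs : List A) (ys : List B) →
                     ∑ (cartesianProduct xs ys) f ≡ ∑[ x ← xs ] ∑[ y ← ys ] f (x , y)
∑-cartesianProduct f []       ys = refl
∑-cartesianProduct f (x ∷ xs) ys = trans (∑-++ f (map (x ,_) ys) _)
  (cong₂ _+_ (∑-map f (x ,_) ys) (∑-cartesianProduct f xs ys))

∑-allFin-suc : ∀ {n} (f : Fin (suc n) → ℕ) →
               ∑ (allFin (suc n)) f ≡ f zero + (∑[ x ← allFin n ] f (suc x))
∑-allFin-suc {n} f = cong (λ xs → f zero + sum xs)
  (trans (map-tabulate suc f) (sym (map-tabulate id (f ∘ suc))))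

-- Degrees in a strict partial order and the bound on the sum of minimum degrees.

module _ {A : Set} {_≺_ : Rel A 0ℓ} (isDSPO : IsDecStrictPartialOrder _≡_ _≺_) where
  open IsDecStrictPartialOrder isDSPO using (asym; irrefl) renaming (trans to ≺-trans; _<?_ to _≺?_)

  above below : List A → A → ℕ
  above xs x = ∑[ y ← xs ] ⟦ x ≺? y ⟧
  below xs x = ∑[ y ← xs ] ⟦ y ≺? x ⟧

  ∑-above≡∑-below : ∀ xs → ∑ xs (above xs) ≡ ∑ xs (below xs)
  ∑-above≡∑-below xs = ∑-swap (λ x y → ⟦ x ≺? y ⟧) xs xs

  above-anti : ∀ xs {x y} → x ≺ y → above xs y ≤ above xs x
  above-anti xs x≺y = ∑-mono xs (λ z → ⟦⟧-mono (_ ≺? z) (_ ≺? z) (≺-trans x≺y))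

  below-mono : ∀ xs {x y} → x ≺ y → below xs x ≤ below xs y
  below-mono xs x≺y = ∑-mono xs (λ z → ⟦⟧-mono (z ≺? _) (z ≺? _) (λ z≺x → ≺-trans z≺x x≺y))

  -- The candidate found in the tail is replaced by the new head only when the head lies above it.
  -- The permutation brings the chosen element to the front, where the induction on lists can delete
  -- it.
  maximal-or-none : {P : A → Set} → Decidable P → ∀ xs →
    All (λ x → ¬ P x) xs ⊎
    (Σ[ v ∈ A ] Σ[ ys ∈ List A ] (xs ↭ v ∷ ys) × P v × All (λ y → v ≺ y → ¬ P y) ys)
  maximal-or-none P? [] = inj₁ []
  maximal-or-none P? (x ∷ xs) with P? x | maximal-or-none P? xs
  ... | no ¬px | inj₁ none = inj₁ (¬px ∷ none)
  ... | yes px | inj₁ none =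
    inj₂ (x , xs , ↭-refl , px , All.map (λ ¬p _ → ¬p) none)
  ... | no ¬px | inj₂ (v , ys , xs↭ , pv , mx) =
    inj₂ (v , x ∷ ys , ↭-trans (prep x xs↭) (swap x v ↭-refl) , pv , (λ _ → ¬px) ∷ mx)
  ... | yes px | inj₂ (v , ys , xs↭ , pv , mx) with v ≺? x
  -- The old candidate `v` joins the rest: it is not above `x` by asymmetry, and whatever is above
  -- `x` is above `v` too.
  ...   | yes v≺x = inj₂ (x , v ∷ ys , prep x xs↭ , px ,
                      (λ x≺v → contradiction x≺v (asym v≺x)) ∷
                      All.map (λ f x≺y → f (≺-trans v≺x x≺y)) mx)
  ...   | no v⊀x  = inj₂ (v , x ∷ ys , ↭-trans (prep x xs↭) (swap x v ↭-refl) , pv ,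
                      (λ v≺x → contradiction v≺x v⊀x) ∷ mx)

  above-∷-self : ∀ v ys → above (v ∷ ys) v ≡ above ys v
  above-∷-self v ys = cong (_+ above ys v) (⟦⟧-false (v ≺? v) (irrefl refl))

  below-∷-self : ∀ v ys → below (v ∷ ys) v ≡ below ys v
  below-∷-self v ys = cong (_+ below ys v) (⟦⟧-false (v ≺? v) (irrefl refl))

  -- Removing v ∈ {below ≤ above}, maximal there, leaves every other minimum
  -- unchanged: elements below v lose from the larger of their two degrees, and
  -- elements above v are outside the set and also lose from the larger one.
  min-unchanged : ∀ v ys → let xs = v ∷ ys in below xs v ≤ above xs v → ∀ y →
                  (v ≺ y → ¬ below xs y ≤ above xs y) →
                  above xs y ⊓ below xs y ≡ above ys y ⊓ below ys y
  min-unchanged v ys b≤a y mx with y ≺? v | v ≺? y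
  ... | yes y≺v | yes v≺y = contradiction v≺y (asym y≺v)
  ... | no _    | no _    = refl
  ... | no _    | yes v≺y = trans (m≤n⇒m⊓n≡m (<⇒≤ a<b)) (sym (m≤n⇒m⊓n≡m (s≤s⁻¹ a<b)))
    where
    a<b : above ys y < suc (below ys y)
    a<b = ≰⇒> (mx v≺y)
  ... | yes y≺v | no _    = trans (m≥n⇒m⊓n≡n (m≤n⇒m≤1+n b≤a′)) (sym (m≥n⇒m⊓n≡n b≤a′))
    where
    b≤a″ : below ys v ≤ above ys v
    b≤a″ = subst₂ _≤_ (below-∷-self v ys) (above-∷-self v ys) b≤a
    -- The inequality at `v` passes down to `y`, which has no more elements below it and no fewer
    -- above it than `v`.
    b≤a′ : below ys y ≤ above ys y
    b≤a′ = ≤-trans (below-mono ys y≺v) (≤-trans b≤a″ (above-anti ys y≺v))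

  above-↭ : ∀ {xs ys} → xs ↭ ys → ∀ x → above xs x ≡ above ys x
  above-↭ p x = ∑-↭ (λ y → ⟦ x ≺? y ⟧) p

  below-↭ : ∀ {xs ys} → xs ↭ ys → ∀ x → below xs x ≡ below ys x
  below-↭ p x = ∑-↭ (λ y → ⟦ y ≺? x ⟧) p

  minDegrees : List A → ℕ
  minDegrees xs = ∑[ x ← xs ] (above xs x ⊓ below xs x)

  comparable : List A → ℕ
  comparable xs = ∑ xs (above xs)

  minDegrees-↭ : ∀ {xs ys} → xs ↭ ys → minDegrees xs ≡ minDegrees ys
  minDegrees-↭ {xs} p = trans (∑-cong xs (λ x → cong₂ _⊓_ (above-↭ p x) (below-↭ p x))) (∑-↭ _ p)

  comparable-↭ : ∀ {xs ys} → xs ↭ ys → comparable xs ≡ comparable ys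
  comparable-↭ {xs} p = trans (∑-cong xs (above-↭ p)) (∑-↭ _ p)

  comparable-∷ : ∀ v ys → comparable (v ∷ ys) ≡ above ys v + (below ys v + comparable ys)
  comparable-∷ v ys = cong₂ _+_ (above-∷-self v ys) (∑-+ (λ x → ⟦ x ≺? v ⟧) (above ys) ys)

  -- The recursion runs on the length, because the list left after deleting `v` comes out of a
  -- permutation and is not a subterm of `xs`.
  2minDegrees≤comparable : ∀ n xs → length xs ≡ n → 2 * minDegrees xs ≤ comparable xs
  2minDegrees≤comparable _       []           _   = z≤n
  2minDegrees≤comparable (suc n) xs@(x ∷ xs′) len
    with maximal-or-none (λ y → below xs y ≤? above xs y) xs
  -- If `below` exceeded `above` at every entry, the sums over the nonempty list would differ,
  -- although both count the comparable pairs.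
  ... | inj₁ none = contradiction (∑-above≡∑-below xs) (<⇒≢ (∑-mono-< (All.map ≰⇒> none)))
  ... | inj₂ (v , ys , xs↭ , b≤a , mx) = begin
    2 * minDegrees xs
      ≡⟨ cong (2 *_) (minDegrees-↭ xs↭) ⟩
    2 * minDegrees (v ∷ ys)
      ≡⟨ cong (λ m → 2 * (above vys v ⊓ below vys v + m))
           (∑-cong-All (All.map (λ {y} → min-unchanged v ys b≤a′ y) mx′)) ⟩
    2 * (above vys v ⊓ below vys v + minDegrees ys)
      ≡⟨ cong (λ m → 2 * (m + minDegrees ys)) (trans (m≥n⇒m⊓n≡n b≤a′) (below-∷-self v ys)) ⟩
    2 * (below ys v + minDegrees ys)
      ≡⟨ double (below ys v) (minDegrees ys) ⟩
    below ys v + (below ys v + 2 * minDegrees ys)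
      ≤⟨ +-mono-≤ b≤a″ (+-monoʳ-≤ (below ys v)
           (2minDegrees≤comparable n ys (suc-injective (trans (sym (↭-length xs↭)) len)))) ⟩
    above ys v + (below ys v + comparable ys)
      ≡⟨ comparable-∷ v ys ⟨
    comparable (v ∷ ys)
      ≡⟨ comparable-↭ xs↭ ⟨
    comparable xs
      ∎
    where
    open ≤-Reasoning
    vys = v ∷ ys
    b≤a′ : below vys v ≤ above vys v
    b≤a′ = subst₂ _≤_ (below-↭ xs↭ v) (above-↭ xs↭ v) b≤a
    b≤a″ : below ys v ≤ above ys v
    b≤a″ = subst₂ _≤_ (below-∷-self v ys) (above-∷-self v ys) b≤a′
    mx′ : All (λ y → v ≺ y → ¬ below vys y ≤ above vys y) ys
    mx′ = All.map (λ {y} f v≺y →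
      subst₂ (λ b a → ¬ b ≤ a) (below-↭ xs↭ y) (above-↭ xs↭ y) (f v≺y)) mx
    double : ∀ a b → 2 * (a + b) ≡ a + (a + 2 * b)
    double = solve-∀

-- The cut that compares the two degrees of each element.

fromDec : ∀ {n} {Q : Fin n → Set} → Decidable Q → Subset n
fromDec Q? = Vec.tabulate (λ x → does (Q? x))

∈-fromDec⁻ : ∀ {n} {Q : Fin n → Set} (Q? : Decidable Q) {x} → x ∈ fromDec Q? → Q x
∈-fromDec⁻ Q? {x} x∈ = decidable-stable (Q? x) λ ¬q →
  contradiction (trans (sym (trans (lookup∘tabulate _ x) (dec-false (Q? x) ¬q))) ([]=⇒lookup x∈)) λ ()

∈-fromDec⁺ : ∀ {n} {Q : Fin n → Set} (Q? : Decidable Q) {x} → Q x → x ∈ fromDec Q?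
∈-fromDec⁺ Q? {x} q = lookup⇒[]= x (fromDec Q?) (trans (lookup∘tabulate _ x) (dec-true (Q? x) q))

splitCut : (P : FinPoset) → Subset (FinPoset.size P) → Cut P
splitCut P B = record { B = B ; U = ∁ B ; covers = p∪∁p≡⊤ B ; disjoint = ∩-inverseʳ B }

module _ (P : FinPoset) where
  open FinPoset P using (size; _≺?_; isDecStrictPartialOrder)

  e-∑ : ∀ X Y → e P X Y ≡ ∑[ x ← allFin size ] ∑[ y ← allFin size ]
                  ⟦ (x ∈? X) ×-dec (y ∈? Y) ×-dec (x ≺? y) ⟧
  e-∑ X Y = trans (length-filter _ (cartesianProduct (allFin size) (allFin size)))
                  (∑-cartesianProduct _ (allFin size) (allFin size))

  up down : Fin size → ℕ
  up   = above isDecStrictPartialOrder (allFin size)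
  down = below isDecStrictPartialOrder (allFin size)

  ePP-∑ : ePP P ≡ ∑ (allFin size) up
  ePP-∑ = trans (e-∑ ⊤ ⊤) (∑-cong (allFin size) λ x → ∑-cong (allFin size) λ y →
    ⟦⟧-cong ((x ∈? ⊤) ×-dec (y ∈? ⊤) ×-dec (x ≺? y)) (x ≺? y)
            (λ (_ , _ , x≺y) → x≺y) (λ x≺y → ∈⊤ , ∈⊤ , x≺y))

  down≤up? : Decidable (λ x → down x ≤ up x)
  down≤up? x = down x ≤? up x

  -- Ties go to the lower part, in agreement with the mark 1 ∸ (below ∸ above) that the program
  -- writes.
  lowerPart : Subset size
  lowerPart = fromDec down≤up?

  balancedCut : Cut P
  balancedCut = splitCut P lowerPart

  ePP≤2*balancedCut : ePP P ≤ 2 * cutSize P balancedCut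
  -- With e(P, P) added to both sides, the minima are bounded from above and nothing has to be
  -- subtracted.
  ePP≤2*balancedCut = +-cancelʳ-≤ (ePP P) _ _ (begin
    ePP P + ePP P
      ≡⟨ double (ePP P) ⟩
    2 * ePP P
      ≤⟨ *-monoʳ-≤ 2 ePP≤ ⟩
    2 * (cutSize P balancedCut + minDegrees isDecStrictPartialOrder xs)
      ≡⟨ *-distribˡ-+ 2 (cutSize P balancedCut) _ ⟩
    2 * cutSize P balancedCut + 2 * minDegrees isDecStrictPartialOrder xs
      ≤⟨ +-monoʳ-≤ (2 * cutSize P balancedCut)
           (2minDegrees≤comparable isDecStrictPartialOrder _ xs refl) ⟩
    2 * cutSize P balancedCut + ∑ xs up
      ≡⟨ cong (2 * cutSize P balancedCut +_) ePP-∑ ⟨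
    2 * cutSize P balancedCut + ePP P
      ∎)
    where
    open ≤-Reasoning
    xs = allFin size
    B = lowerPart
    U = ∁ lowerPart
    double : ∀ a → a + a ≡ 2 * a
    double = solve-∀

    cross intoB fromU : Fin size → Fin size → ℕ
    cross x y = ⟦ (x ∈? B) ×-dec (y ∈? U) ×-dec (x ≺? y) ⟧
    intoB x y = ⟦ y ∈? B ⟧ * ⟦ x ≺? y ⟧
    fromU x y = ⟦ x ∈? U ⟧ * ⟦ x ≺? y ⟧

    -- A comparable pair missed by both `intoB` and `fromU` has `x` in `B` and `y` in `U`, so it
    -- crosses the cut.
    pair≤ : ∀ x y → ⟦ x ≺? y ⟧ ≤ cross x y + (intoB x y + fromU x y)
    pair≤ x y with x ≺? y
    ... | no _ = z≤n
    ... | yes _ with y ∈? B | x ∈? B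
    ...   | yes _  | _       = m≤n⇒m≤o+n _ (s≤s z≤n)
    ...   | no y∉B | no x∉B  rewrite ⟦⟧-true (x ∈? U) (x∉p⇒x∈∁p x∉B) = ≤-refl
    ...   | no y∉B | yes x∈B rewrite dec-true (y ∈? U) (x∉p⇒x∈∁p y∉B) = s≤s z≤n

    -- As `U` is the complement of `B`, exactly one indicator is 1, and the choice of `lowerPart`
    -- makes the surviving degree the smaller one.
    degrees≤min : ∀ x → ⟦ x ∈? B ⟧ * down x + ⟦ x ∈? U ⟧ * up x ≤ up x ⊓ down x
    degrees≤min x with x ∈? B
    ... | yes x∈B rewrite ⟦⟧-false (x ∈? U) (λ x∈U → x∈∁p⇒x∉p x∈U x∈B) =
      ≤-reflexive (trans (one-zero (down x)) (sym (m≥n⇒m⊓n≡n (∈-fromDec⁻ down≤up? x∈B))))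
      where
      one-zero : ∀ a → 1 * a + 0 ≡ a
      one-zero = solve-∀
    ... | no x∉B rewrite ⟦⟧-true (x ∈? U) (x∉p⇒x∈∁p x∉B) =
      ≤-reflexive (trans (*-identityˡ (up x)) (sym (m≤n⇒m⊓n≡m (≰⇒≥ (x∉B ∘ ∈-fromDec⁺ down≤up?)))))

    ePP≤ : ePP P ≤ cutSize P balancedCut + minDegrees isDecStrictPartialOrder xs
    ePP≤ = begin
      ePP P
        ≡⟨ ePP-∑ ⟩
      ∑[ x ← xs ] ∑[ y ← xs ] ⟦ x ≺? y ⟧
        ≤⟨ ∑-mono xs (λ x → ∑-mono xs (pair≤ x)) ⟩
      ∑[ x ← xs ] ∑[ y ← xs ] (cross x y + (intoB x y + fromU x y))
        ≡⟨ ∑-cong xs (λ x → trans (∑-+ (cross x) _ xs) (cong (∑ xs (cross x) +_) (∑-+ (intoB x) (fromU x) xs))) ⟩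
      ∑[ x ← xs ] (∑ xs (cross x) + (∑ xs (intoB x) + ∑ xs (fromU x)))
        ≡⟨ trans (∑-+ _ _ xs) (cong₂ _+_ (sym (e-∑ B U)) (∑-+ _ _ xs)) ⟩
      cutSize P balancedCut + ((∑[ x ← xs ] ∑ xs (intoB x)) + (∑[ x ← xs ] ∑ xs (fromU x)))
        -- Pairs ending in `B` are regrouped by their upper element, hence the swap; pairs starting
        -- in `U` are already grouped by their lower one.
        ≡⟨ cong (cutSize P balancedCut +_) (cong₂ _+_
             (trans (∑-swap intoB xs xs) (∑-cong xs (λ y → ∑-*ˡ ⟦ y ∈? B ⟧ (λ x → ⟦ x ≺? y ⟧) xs)))
             (∑-cong xs (λ x → ∑-*ˡ ⟦ x ∈? U ⟧ (λ y → ⟦ x ≺? y ⟧) xs))) ⟩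
      cutSize P balancedCut + ((∑[ x ← xs ] ⟦ x ∈? B ⟧ * down x) + (∑[ x ← xs ] ⟦ x ∈? U ⟧ * up x))
        ≡⟨ cong (cutSize P balancedCut +_) (∑-+ _ _ xs) ⟨
      cutSize P balancedCut + (∑[ x ← xs ] (⟦ x ∈? B ⟧ * down x + ⟦ x ∈? U ⟧ * up x))
        ≤⟨ +-monoʳ-≤ (cutSize P balancedCut) (∑-mono xs degrees≤min) ⟩
      cutSize P balancedCut + minDegrees isDecStrictPartialOrder xs
        ∎

-- Chains: their pairs and their maximum cuts.

∑-one : ∀ n → ∑[ x ← allFin n ] 1 ≡ n
∑-one zero    = refl
∑-one (suc n) = trans (∑-allFin-suc {n} (λ _ → 1)) (cong suc (∑-one n))

∑-δ : ∀ {n} (x : Fin n) (f : Fin n → ℕ) → ∑[ y ← allFin n ] ⟦ y Fin.≟ x ⟧ * f y ≡ f x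
∑-δ {suc n} zero f = trans (∑-allFin-suc {n} (λ y → ⟦ y Fin.≟ zero ⟧ * f y))
  (trans (cong (1 * f zero +_) (∑-zero (allFin n))) (one-zero (f zero)))
  where
  one-zero : ∀ a → 1 * a + 0 ≡ a
  one-zero = solve-∀
∑-δ {suc n} (suc x) f = trans (∑-allFin-suc (λ y → ⟦ y Fin.≟ suc x ⟧ * f y)) (∑-δ x (λ y → f (suc y)))

-- With the size written as `k + m`, induction on `k` lowers threshold and size together.
∑-<-threshold : ∀ k m → ∑[ x ← allFin (k + m) ] ⟦ toℕ x <? k ⟧ ≡ k
∑-<-threshold zero    m = ∑-zero (allFin m)
∑-<-threshold (suc k) m = trans (∑-allFin-suc {k + m} (λ x → ⟦ toℕ x <? suc k ⟧))
  (cong suc (trans (∑-cong (allFin (k + m)) (λ x → ⟦⟧-cong (suc (toℕ x) <? suc k) (toℕ x <? k) s≤s⁻¹ s≤s))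
                   (∑-<-threshold k m)))

-- With k = a + j the hypothesis gives b ≤ k + j, and (k - j)(k + j) falls short of k² by j².
a≤k⇒a*b≤k*k : ∀ {a k} b → a ≤ k → a + b ≤ k + k → a * b ≤ k * k
a≤k⇒a*b≤k*k {a} b a≤k a+b≤2k with m≤n⇒∃[o]m+o≡n a≤k
... | j , refl = begin
  a * b                    ≤⟨ *-monoʳ-≤ a (+-cancelˡ-≤ a b (a + j + j) (subst (a + b ≤_) (regroup a j) a+b≤2k)) ⟩
  a * (a + j + j)          ≤⟨ m≤m+n _ (j * j) ⟩
  a * (a + j + j) + j * j  ≡⟨ square a j ⟩
  (a + j) * (a + j)        ∎
  where
  open ≤-Reasoning
  regroup : ∀ a j → (a + j) + (a + j) ≡ a + (a + j + j)
  regroup = solve-∀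
  square : ∀ a j → a * (a + j + j) + j * j ≡ (a + j) * (a + j)
  square = solve-∀

a*b≤k*k : ∀ a b k → a + b ≤ k + k → a * b ≤ k * k
a*b≤k*k a b k a+b≤2k with ≤-total a k
... | inj₁ a≤k = a≤k⇒a*b≤k*k b a≤k a+b≤2k
... | inj₂ k≤a = subst (_≤ k * k) (*-comm b a) (a≤k⇒a*b≤k*k a b≤k (subst (_≤ k + k) (+-comm a b) a+b≤2k))
  where
  b≤k : b ≤ k
  b≤k = +-cancelˡ-≤ k b k (≤-trans (+-monoˡ-≤ b k≤a) a+b≤2k)

chain : ℕ → FinPoset
chain n = record
  { size = n
  ; _≺_  = Fin._<_
  ; isDecStrictPartialOrder = record
    { isStrictPartialOrder = Fin.<-isStrictPartialOrder ; _≟_ = Fin._≟_ ; _<?_ = Fin._<?_ }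
  }

-- An element of a chain is comparable to all others, so its two degrees and itself make up n;
-- summing over the elements counts each pair twice. This form of n(n - 1)/2 needs neither
-- subtraction nor division.
ePP-chain : ∀ n → 2 * ePP (chain n) + n ≡ n * n
ePP-chain n = begin
  2 * ePP (chain n) + n
    ≡⟨ cong₂ _+_ (trans (double (ePP (chain n))) (cong₂ _+_ (ePP-∑ (chain n)) ePP-∑-down)) (sym (∑-one n)) ⟩
  ∑ xs (up (chain n)) + ∑ xs (down (chain n)) + (∑[ x ← xs ] 1)
    ≡⟨ cong (_+ (∑[ x ← xs ] 1)) (∑-+ (up (chain n)) (down (chain n)) xs) ⟨
  (∑[ x ← xs ] (up (chain n) x + down (chain n) x)) + (∑[ x ← xs ] 1)
    ≡⟨ ∑-+ (λ x → up (chain n) x + down (chain n) x) (λ _ → 1) xs ⟨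
  ∑[ x ← xs ] (up (chain n) x + down (chain n) x + 1)
    ≡⟨ ∑-cong xs degrees ⟩
  -- The factor 1 gives the summand the shape from which `∑-*ʳ` extracts `n`.
  ∑[ x ← xs ] (1 * n)
    ≡⟨ trans (∑-*ʳ (λ _ → 1) n xs) (cong (_* n) (∑-one n)) ⟩
  n * n
    ∎
  where
  open ≡-Reasoning
  open FinPoset (chain n) using (_≺?_; isDecStrictPartialOrder)
  xs = allFin n
  double : ∀ a → 2 * a ≡ a + a
  double = solve-∀
  ePP-∑-down : ePP (chain n) ≡ ∑ xs (down (chain n))
  ePP-∑-down = trans (ePP-∑ (chain n)) (∑-above≡∑-below isDecStrictPartialOrder xs)
  trichotomy : ∀ x y → ⟦ x ≺? y ⟧ + ⟦ y ≺? x ⟧ + ⟦ y Fin.≟ x ⟧ * 1 ≡ 1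
  trichotomy x y with Fin.<-cmp x y
  ... | tri< x<y x≢y x≯y = cong₂ _+_ (cong₂ _+_ (⟦⟧-true (x ≺? y) x<y) (⟦⟧-false (y ≺? x) x≯y))
                                     (cong (_* 1) (⟦⟧-false (y Fin.≟ x) (x≢y ∘ sym)))
  ... | tri≈ x≮y x≡y x≯y = cong₂ _+_ (cong₂ _+_ (⟦⟧-false (x ≺? y) x≮y) (⟦⟧-false (y ≺? x) x≯y))
                                     (cong (_* 1) (⟦⟧-true (y Fin.≟ x) (sym x≡y)))
  ... | tri> x≮y x≢y x>y = cong₂ _+_ (cong₂ _+_ (⟦⟧-false (x ≺? y) x≮y) (⟦⟧-true (y ≺? x) x>y))
                                     (cong (_* 1) (⟦⟧-false (y Fin.≟ x) (x≢y ∘ sym)))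
  degrees : ∀ x → up (chain n) x + down (chain n) x + 1 ≡ 1 * n
  degrees x = begin
    up (chain n) x + down (chain n) x + 1
      ≡⟨ cong₂ _+_ (sym (∑-+ _ _ xs)) (sym (∑-δ x (λ _ → 1))) ⟩
    (∑[ y ← xs ] (⟦ x ≺? y ⟧ + ⟦ y ≺? x ⟧)) + (∑[ y ← xs ] ⟦ y Fin.≟ x ⟧ * 1)
      ≡⟨ ∑-+ _ _ xs ⟨
    ∑[ y ← xs ] (⟦ x ≺? y ⟧ + ⟦ y ≺? x ⟧ + ⟦ y Fin.≟ x ⟧ * 1)
      ≡⟨ ∑-cong xs (trichotomy x) ⟩
    ∑[ y ← xs ] 1
      ≡⟨ trans (∑-one n) (sym (*-identityˡ n)) ⟩
    1 * n
      ∎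

∑∑-* : ∀ {n} (f g : Fin n → ℕ) →
       ∑[ x ← allFin n ] ∑[ y ← allFin n ] f x * g y ≡ ∑ (allFin n) f * ∑ (allFin n) g
∑∑-* {n} f g = trans (∑-cong (allFin n) (λ x → ∑-*ˡ (f x) g (allFin n))) (∑-*ʳ f _ (allFin n))

-- Dropping the order condition leaves the product |B| |U|, whose factors have sum at most 2k by
-- disjointness.
cutSize≤ : ∀ P (C : Cut P) {k} → FinPoset.size P ≡ k + k → cutSize P C ≤ k * k
cutSize≤ P C {k} size≡ = begin
  cutSize P C
    ≡⟨ e-∑ P B U ⟩
  ∑[ x ← xs ] ∑[ y ← xs ] ⟦ cross? x y ⟧
    ≤⟨ ∑-mono xs (λ x → ∑-mono xs (λ y → ≤-trans
         (⟦⟧-mono (cross? x y) ((x ∈? B) ×-dec (y ∈? U)) (λ (x∈B , y∈U , _) → x∈B , y∈U))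
         (≤-reflexive (⟦⟧-× (x ∈? B) (y ∈? U))))) ⟩
  ∑[ x ← xs ] ∑[ y ← xs ] ⟦ x ∈? B ⟧ * ⟦ y ∈? U ⟧
    ≡⟨ ∑∑-* (λ x → ⟦ x ∈? B ⟧) (λ y → ⟦ y ∈? U ⟧) ⟩
  (∑[ x ← xs ] ⟦ x ∈? B ⟧) * (∑[ x ← xs ] ⟦ x ∈? U ⟧)
    ≤⟨ a*b≤k*k (∑[ x ← xs ] ⟦ x ∈? B ⟧) (∑[ x ← xs ] ⟦ x ∈? U ⟧) k (begin
         (∑[ x ← xs ] ⟦ x ∈? B ⟧) + (∑[ x ← xs ] ⟦ x ∈? U ⟧)  ≡⟨ ∑-+ _ _ xs ⟨
         ∑[ x ← xs ] (⟦ x ∈? B ⟧ + ⟦ x ∈? U ⟧)                ≤⟨ ∑-mono xs disjoint′ ⟩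
         ∑[ x ← xs ] 1                                        ≡⟨ trans (∑-one size) size≡ ⟩
         k + k                                                ∎) ⟩
  k * k
    ∎
  where
  open ≤-Reasoning
  open FinPoset P using (size; _≺_; _≺?_)
  open Cut C
  xs = allFin size
  cross? : ∀ x y → Dec (x ∈ B × y ∈ U × x ≺ y)
  cross? x y = (x ∈? B) ×-dec (y ∈? U) ×-dec (x ≺? y)
  disjoint′ : ∀ x → ⟦ x ∈? B ⟧ + ⟦ x ∈? U ⟧ ≤ 1
  disjoint′ x with x ∈? B | x ∈? U
  ... | yes x∈B | yes x∈U = contradiction (subst (x ∈_) disjoint (x∈p∩q⁺ (x∈B , x∈U))) ∉⊥
  ... | yes _   | no _    = ≤-refl
  ... | no _    | yes _   = ≤-refl
  ... | no _    | no _    = z≤n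

module _ (k : ℕ) where
  private xs = allFin (k + k)

  toℕ<k? : Decidable (λ (x : Fin (k + k)) → toℕ x < k)
  toℕ<k? x = toℕ x <? k

  halfCut : Cut (chain (k + k))
  halfCut = splitCut (chain (k + k)) (fromDec toℕ<k?)

  ∑-≥-threshold : ∑[ x ← xs ] ⟦ k ≤? toℕ x ⟧ ≡ k
  ∑-≥-threshold = +-cancelˡ-≡ k _ _ (begin
    k + (∑[ x ← xs ] ⟦ k ≤? toℕ x ⟧)
      ≡⟨ cong (_+ (∑[ x ← xs ] ⟦ k ≤? toℕ x ⟧)) (∑-<-threshold k k) ⟨
    (∑[ x ← xs ] ⟦ toℕ x <? k ⟧) + (∑[ x ← xs ] ⟦ k ≤? toℕ x ⟧)
      ≡⟨ ∑-+ _ _ xs ⟨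
    ∑[ x ← xs ] (⟦ toℕ x <? k ⟧ + ⟦ k ≤? toℕ x ⟧)
      ≡⟨ ∑-cong xs dichotomy ⟩
    ∑[ x ← xs ] 1
      ≡⟨ ∑-one (k + k) ⟩
    k + k
      ∎)
    where
    open ≡-Reasoning
    dichotomy : ∀ (x : Fin (k + k)) → ⟦ toℕ x <? k ⟧ + ⟦ k ≤? toℕ x ⟧ ≡ 1
    dichotomy x with <-≤-connex (toℕ x) k
    ... | inj₁ x<k = cong₂ _+_ (⟦⟧-true (toℕ x <? k) x<k) (⟦⟧-false (k ≤? toℕ x) (<⇒≱ x<k))
    ... | inj₂ k≤x = cong₂ _+_ (⟦⟧-false (toℕ x <? k) (≤⇒≯ k≤x)) (⟦⟧-true (k ≤? toℕ x) k≤x)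

  -- Whatever lies below the threshold precedes whatever does not, so the order condition is
  -- automatic and the double sum factors.
  cutSize-halfCut : cutSize (chain (k + k)) halfCut ≡ k * k
  cutSize-halfCut = begin
    cutSize (chain (k + k)) halfCut
      ≡⟨ e-∑ (chain (k + k)) B U ⟩
    ∑[ x ← xs ] ∑[ y ← xs ] ⟦ cross? x y ⟧
      ≡⟨ ∑-cong xs (λ x → ∑-cong xs (λ y → trans
           (⟦⟧-cong (cross? x y) ((toℕ x <? k) ×-dec (k ≤? toℕ y)) (to x y) (from x y))
           (⟦⟧-× (toℕ x <? k) (k ≤? toℕ y)))) ⟩
    ∑[ x ← xs ] ∑[ y ← xs ] ⟦ toℕ x <? k ⟧ * ⟦ k ≤? toℕ y ⟧
      ≡⟨ ∑∑-* {k + k} (λ x → ⟦ toℕ x <? k ⟧) (λ y → ⟦ k ≤? toℕ y ⟧) ⟩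
    (∑[ x ← xs ] ⟦ toℕ x <? k ⟧) * (∑[ y ← xs ] ⟦ k ≤? toℕ y ⟧)
      ≡⟨ cong₂ _*_ (∑-<-threshold k k) ∑-≥-threshold ⟩
    k * k
      ∎
    where
    open ≡-Reasoning
    open FinPoset (chain (k + k)) using (_≺_; _≺?_)
    open Cut halfCut
    cross? : ∀ (x y : Fin (k + k)) → Dec (x ∈ B × y ∈ U × x ≺ y)
    cross? x y = (x ∈? B) ×-dec (y ∈? U) ×-dec (x ≺? y)
    to : ∀ (x y : Fin (k + k)) → x ∈ B × y ∈ U × toℕ x < toℕ y → toℕ x < k × k ≤ toℕ y
    to x y (x∈B , y∈U , _) = ∈-fromDec⁻ toℕ<k? x∈B , ≮⇒≥ (λ y<k → x∈∁p⇒x∉p y∈U (∈-fromDec⁺ toℕ<k? y<k))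
    from : ∀ (x y : Fin (k + k)) → toℕ x < k × k ≤ toℕ y → x ∈ B × y ∈ U × toℕ x < toℕ y
    from x y (x<k , k≤y) =
      ∈-fromDec⁺ toℕ<k? x<k , x∉p⇒x∈∁p (λ y∈B → ≤⇒≯ k≤y (∈-fromDec⁻ toℕ<k? y∈B)) , <-≤-trans x<k k≤y

-- The factor `suc n` is shared with the maximum cut `suc n * suc n`, so their ratio is (n + 1)/(2n
-- + 1), that is, half of 1 + 1/(2n + 1).
ePP-even-chain : ∀ n → ePP (chain (suc n + suc n)) ≡ suc n * suc (2 * n)
ePP-even-chain n = *-cancelˡ-≡ _ _ 2 (+-cancelʳ-≡ (suc n + suc n) _ _
  (trans (ePP-chain (suc n + suc n)) (square n)))
  where
  square : ∀ n → (suc n + suc n) * (suc n + suc n) ≡ 2 * (suc n * suc (2 * n)) + (suc n + suc n)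
  square = solve-∀

-- The error term and the asymptotic ratio.

1/odd : ℕ → ℚ
1/odd n = mkℚ (ℤ.+ 1) (2 * n) (1-coprimeTo (suc (2 * n)))

1/odd→0 : TendsToZero 1/odd
-- For δ = (p + 1)/(d + 1) the claim becomes d + 1 < (p + 1)(2n + 1), which holds once n ≥ d + 1.
1/odd→0 (mkℚ (ℤ.+ suc p) d _) _ = suc d , λ n d<n → ℚ.*<*
  (subst₂ ℤ._<_ (sym (ℤ.*-identityˡ _)) (ℤ.pos-* (suc p) (suc (2 * n)))
    (ℤ.+<+ (≤-trans (s≤s d<n) (≤-trans (s≤s (m≤n*m n 2)) (m≤n*m (suc (2 * n)) (suc p))))))
1/odd→0 (mkℚ (ℤ.+ zero) _ _) (ℚ.*<* (ℤ.+<+ ()))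
1/odd→0 (mkℚ (ℤ.-[1+ _ ]) _ _) (ℚ.*<* ())

-- The identity is transferred to unnormalised rationals, where no common factors are cancelled and
-- equality is cross multiplication, leaving a polynomial identity over ℕ.
tight-ratio : ∀ n → fromℕ (suc n * suc n) ≡ ((1ℚ ℚ.+ 1/odd n) ℚ.* ½) ℚ.* fromℕ (suc n * suc (2 * n))
tight-ratio n = ℚ.toℚᵘ-injective (begin-equality
  toℚᵘ (fromℕ (k * k))
    ≃⟨ ℚ.toℚᵘ-fromℚᵘ (mkℚᵘ (ℤ.+ (k * k)) 0) ⟩
  mkℚᵘ (ℤ.+ (k * k)) 0
    ≃⟨ *≡* (cong ℤ.+_ (cross-multiplied n)) ⟩
  ((ℚᵘ.1ℚᵘ ℚᵘ.+ toℚᵘ ε) ℚᵘ.* toℚᵘ ½) ℚᵘ.* mkℚᵘ (ℤ.+ (k * q)) 0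
    ≃⟨ ℚᵘ.*-cong (ℚᵘ.*-congʳ (ℚ.toℚᵘ-homo-+ 1ℚ ε)) (ℚ.toℚᵘ-fromℚᵘ (mkℚᵘ (ℤ.+ (k * q)) 0)) ⟨
  (toℚᵘ (1ℚ ℚ.+ ε) ℚᵘ.* toℚᵘ ½) ℚᵘ.* toℚᵘ (fromℕ (k * q))
    ≃⟨ ℚᵘ.*-congʳ (ℚ.toℚᵘ-homo-* (1ℚ ℚ.+ ε) ½) ⟨
  toℚᵘ ((1ℚ ℚ.+ ε) ℚ.* ½) ℚᵘ.* toℚᵘ (fromℕ (k * q))
    ≃⟨ ℚ.toℚᵘ-homo-* ((1ℚ ℚ.+ ε) ℚ.* ½) (fromℕ (k * q)) ⟨
  toℚᵘ (((1ℚ ℚ.+ ε) ℚ.* ½) ℚ.* fromℕ (k * q))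
    ∎)
  where
  open ℚᵘ.≤-Reasoning
  -- The products by 1 and 2 are the numerators and denominators of 1ℚ, ½ and the integers.
  cross-multiplied : ∀ n → (suc n * suc n) * (((1 * suc (2 * n)) * 2) * 1) ≡
                     ((((1 * suc (2 * n) + 1 * 1) * 1) * (suc n * suc (2 * n)))) * 1
  cross-multiplied = solve-∀
  k = suc n
  q = suc (2 * n)
  ε = 1/odd n

-- The linear-time program and its execution.

-- Registers: 1 = |P|, then the element being marked; 2 = 1; 3 = number of pairs
-- left; 4 = address of the next pair; 5 = A, the first cell after the input;
-- 6 = A + |P|; 7, 8 = scratch.  Cells A + x and A + |P| + x count the elements
-- above and below x.  The loop at 8 reads the pairs, the loop at 23 writes
-- 1 ∸ (below ∸ above) into cell x, which is 1 if below ≤ above and 0 otherwise.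
cutProgram : Program
cutProgram =
    load 1 0
  ∷ const 2 1
  ∷ load 3 2
  ∷ const 4 2
  ∷ add 4 4 1
  ∷ add 5 4 3
  ∷ add 5 5 3
  ∷ add 6 5 1
  ∷ jumpIf0 3 23
  ∷ load 7 4
  ∷ add 7 7 5
  ∷ load 8 7
  ∷ add 8 8 2
  ∷ store 7 8
  ∷ add 4 4 2
  ∷ load 7 4
  ∷ add 7 7 6
  ∷ load 8 7
  ∷ add 8 8 2
  ∷ store 7 8
  ∷ add 4 4 2
  ∷ sub 3 3 2
  ∷ jump 8
  ∷ jumpIf0 1 33
  ∷ sub 1 1 2
  ∷ add 7 5 1
  ∷ load 7 7
  ∷ add 8 6 1
  ∷ load 8 8
  ∷ sub 8 8 7
  ∷ sub 8 2 8
  ∷ store 1 8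
  ∷ jump 23
  ∷ []

run-+ : ∀ prog s t σ → run prog (s + t) σ ≡ run prog t (run prog s σ)
run-+ prog zero    t σ = refl
run-+ prog (suc s) t σ = run-+ prog s t (step prog σ)

-- A record rather than an abbreviation, so that comparing two such statements
-- never makes the type checker run the program.
infix 4 _—⟨_⟩→_
record _—⟨_⟩→_ (σ : State) (t : ℕ) (τ : State) : Set where
  constructor ran
  field
    run≡ : run cutProgram t σ ≡ τ

_⨾_ : ∀ {s t σ τ υ} → σ —⟨ s ⟩→ τ → τ —⟨ t ⟩→ υ → σ —⟨ s + t ⟩→ υ
_⨾_ {s} {t} {σ} (ran p) (ran q) = ran (trans (run-+ cutProgram s t σ)
  (trans (cong (run cutProgram t) p) q))

[≔]-same : ∀ f i v → (f [ i ≔ v ]) i ≡ v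
[≔]-same f i v rewrite dec-true (i ≟ i) refl = refl

[≔]-other : ∀ f {i j} v → i ≢ j → (f [ i ≔ v ]) j ≡ f j
[≔]-other f {i} {j} v i≢j rewrite dec-false (i ≟ j) i≢j = refl

bump : (ℕ → ℕ) → ℕ → ℕ → ℕ
bump m a = m [ a ≔ m a + 1 ]

bump-Fin : ∀ {n} m b (x y : Fin n) → bump m (toℕ y + b) (toℕ x + b) ≡ ⟦ y Fin.≟ x ⟧ + m (toℕ x + b)
bump-Fin m b x y with y Fin.≟ x
... | yes refl = trans ([≔]-same m (toℕ x + b) _) (+-comm _ 1)
... | no y≢x   = [≔]-other m _ (λ eq → y≢x (Fin.toℕ-injective (+-cancelʳ-≡ b _ _ eq)))

-- On all pairs of the order these are the upper and lower degrees; on a tail of the list they are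
-- the amounts still to be counted.
source target : ∀ {n} → List (Fin n × Fin n) → Fin n → ℕ
source qs x = ∑[ q ← qs ] ⟦ proj₁ q Fin.≟ x ⟧
target qs x = ∑[ q ← qs ] ⟦ proj₂ q Fin.≟ x ⟧

Reads : ∀ {n} → (ℕ → ℕ) → ℕ → List (Fin n × Fin n) → Set
Reads m p []             = Unit
Reads m p ((x , y) ∷ qs) = m p ≡ toℕ x × m (p + 1) ≡ toℕ y × Reads m (p + 1 + 1) qs

Reads-suc : ∀ {n} u vs p (qs : List (Fin n × Fin n)) →
            Reads (memory vs) p qs → Reads (memory (u ∷ vs)) (suc p) qs
Reads-suc u vs p []       _               = tt
Reads-suc u vs p (q ∷ qs) (eq , eq′ , rs) = eq , eq′ , Reads-suc u vs (p + 1 + 1) qs rs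

flatten : ∀ {n} → List (Fin n × Fin n) → List ℕ
flatten = concatMap (λ (x , y) → toℕ x ∷ toℕ y ∷ [])

Reads-flatten : ∀ {n} us (qs : List (Fin n × Fin n)) →
                Reads (memory (us ++ flatten qs)) (length us) qs
Reads-flatten []       []       = tt
Reads-flatten []       ((x , y) ∷ qs) = refl , refl ,
  Reads-suc (toℕ x) (toℕ y ∷ flatten qs) 1 qs (Reads-suc (toℕ y) (flatten qs) 0 qs (Reads-flatten [] qs))
Reads-flatten (u ∷ us) qs       = Reads-suc u (us ++ flatten qs) (length us) qs (Reads-flatten us qs)

length-flatten : ∀ {n} (qs : List (Fin n × Fin n)) → length (flatten qs) ≡ length qs + length qs
length-flatten []       = refl
length-flatten (q ∷ qs) = cong suc (trans (cong suc (length-flatten qs))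
  (sym (+-suc (length qs) (length qs))))

-- This is why the counters, placed after the input, start at 0.
memory-beyond : ∀ vs {a} → length vs ≤ a → memory vs a ≡ 0
memory-beyond []       _         = refl
memory-beyond (_ ∷ vs) (s≤s len) = memory-beyond vs len

-- The branch taken depends on a register whose value is known only by a proof, so this step does
-- not compute by itself, unlike the straight-line blocks.
jumpIf0-zero : ∀ {p i l r m} → fetch cutProgram p ≡ just (jumpIf0 i l) → r i ≡ 0 →
               ⟨ p , r , m ⟩ —⟨ 1 ⟩→ ⟨ l , r , m ⟩
jumpIf0-zero {p} {i} {l} {r} {m} fetched r≡0 = ran (jumped r≡0)
  where
  jumped : r i ≡ 0 → step cutProgram ⟨ p , r , m ⟩ ≡ ⟨ l , r , m ⟩
  jumped eq rewrite fetched | eq = refl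

jumpIf0-suc : ∀ {p i l r m k} → fetch cutProgram p ≡ just (jumpIf0 i l) → r i ≡ suc k →
              ⟨ p , r , m ⟩ —⟨ 1 ⟩→ ⟨ suc p , r , m ⟩
jumpIf0-suc {p} {i} {l} {r} {m} {k} fetched r≡suc = ran (passed r≡suc)
  where
  passed : r i ≡ suc k → step cutProgram ⟨ p , r , m ⟩ ≡ ⟨ suc p , r , m ⟩
  passed eq rewrite fetched | eq = refl

-- Everything is expressed through the registers themselves, so that `refl` executes the block. The
-- second element of the pair is loaded from `m₁`, after the first counter has changed.
pairBody : ∀ r m → let a = m (r 4) + r 5 ; m₁ = m [ a ≔ m a + r 2 ] ; b = m₁ (r 4 + r 2) + r 6 in
  Σ[ r′ ∈ (ℕ → ℕ) ]
    ⟨ 9 , r , m ⟩ —⟨ 14 ⟩→ ⟨ 8 , r′ , m₁ [ b ≔ m₁ b + r 2 ] ⟩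
    × r′ 1 ≡ r 1 × r′ 2 ≡ r 2 × r′ 3 ≡ r 3 ∸ r 2 × r′ 4 ≡ r 4 + r 2 + r 2 × r′ 5 ≡ r 5 × r′ 6 ≡ r 6
pairBody r m = _ , ran refl , refl , refl , refl , refl , refl , refl

markBody : ∀ r m → let i = r 1 ∸ r 2 in
  Σ[ r′ ∈ (ℕ → ℕ) ]
    ⟨ 24 , r , m ⟩ —⟨ 9 ⟩→ ⟨ 23 , r′ , m [ i ≔ r 2 ∸ (m (r 6 + i) ∸ m (r 5 + i)) ] ⟩
    × r′ 1 ≡ i × r′ 2 ≡ r 2 × r′ 5 ≡ r 5 × r′ 6 ≡ r 6
markBody r m = _ , ran refl , refl , refl , refl , refl

setup : ∀ m → Σ[ r ∈ (ℕ → ℕ) ]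
  ⟨ 0 , (λ _ → 0) , m ⟩ —⟨ 8 ⟩→ ⟨ 8 , r , m ⟩
  × r 1 ≡ m 0 × r 2 ≡ 1 × r 3 ≡ m 1 × r 4 ≡ 2 + m 0
  × r 5 ≡ 2 + m 0 + m 1 + m 1 × r 6 ≡ 2 + m 0 + m 1 + m 1 + m 0
setup m = _ , ran refl , refl , refl , refl , refl , refl , refl

bump-< : ∀ m {a j} → j < a → bump m a j ≡ m j
bump-< m j<a = [≔]-other m _ (>⇒≢ j<a)

bump-> : ∀ m {a j} → a < j → bump m a j ≡ m j
bump-> m a<j = [≔]-other m _ (<⇒≢ a<j)

-- The memory left by `pairBody`, with the register contents abstracted so that their known values
-- can be substituted.
bumps : (ℕ → ℕ) → (one p A B : ℕ) → ℕ → ℕ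
bumps m one p A B =
  let a = m p + A ; m₁ = m [ a ≔ m a + one ] ; b = m₁ (p + one) + B in m₁ [ b ≔ m₁ b + one ]

-- The late read of the second element is harmless: cell `p + 1` lies before `A′`, and the first
-- counter does not.
bumps≡bump² : ∀ m {one p A A′ B B′ x y} → one ≡ 1 → A ≡ A′ → B ≡ B′ →
              m p ≡ x → m (p + 1) ≡ y → p + 1 < A′ →
              bumps m one p A B ≡ bump (bump m (x + A′)) (y + B′)
bumps≡bump² m {p = p} {A} {B = B} refl refl refl refl eq p+1<A =
  cong (λ y → bump (bump m (m p + A)) (y + B))
    (trans (bump-< m (<-≤-trans p+1<A (m≤n+m A (m p)))) eq)

-- The fixed `m₀` holds the input, and the invariant is that the current memory agrees with it below
-- `A`. Counters are described as increments over `m`, which suits the induction on the unread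
-- pairs. Each pair costs one test and 14 further instructions, and the exit test costs 1.
pairLoop : ∀ {n} A m₀ (qs : List (Fin n × Fin n)) p r m →
  r 2 ≡ 1 → r 3 ≡ length qs → r 4 ≡ p → r 5 ≡ A → r 6 ≡ n + A →
  Reads m₀ p qs → p + (length qs + length qs) ≤ A → (∀ j → j < A → m j ≡ m₀ j) →
  Σ[ r′ ∈ (ℕ → ℕ) ] Σ[ m′ ∈ (ℕ → ℕ) ]
    ⟨ 8 , r , m ⟩ —⟨ length qs * 15 + 1 ⟩→ ⟨ 23 , r′ , m′ ⟩
    × r′ 1 ≡ r 1 × r′ 2 ≡ 1 × r′ 5 ≡ A × r′ 6 ≡ n + A
    × (∀ x → m′ (toℕ x + A) ≡ source qs x + m (toℕ x + A))
    × (∀ x → m′ (toℕ x + (n + A)) ≡ target qs x + m (toℕ x + (n + A)))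
pairLoop A m₀ [] p r m r2 r3 r4 r5 r6 rs len agree =
  r , m , jumpIf0-zero refl r3 , refl , r2 , r5 , r6 , (λ _ → refl) , (λ _ → refl)
pairLoop {n} A m₀ ((x , y) ∷ qs) p r m r2 r3 refl r5 r6 (readx , ready , rs) len agree
  with pairBody r m
... | r₁ , body , e1 , e2 , e3 , e4 , e5 , e6
  with pairLoop A m₀ qs (r 4 + 1 + 1) r₁ (bump (bump m (toℕ x + A)) (toℕ y + (n + A)))
         (trans e2 r2) (trans e3 (cong₂ _∸_ r3 r2)) (trans e4 (cong (λ o → r 4 + o + o) r2))
         (trans e5 r5) (trans e6 r6) rs (subst (_≤ A) (regroup (r 4) (length qs)) len) agree′
  where
  regroup : ∀ p l → p + (suc l + suc l) ≡ p + 1 + 1 + (l + l)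
  regroup = solve-∀
  agree′ : ∀ j → j < A → bump (bump m (toℕ x + A)) (toℕ y + (n + A)) j ≡ m₀ j
  agree′ j j<A =
    trans (bump-< (bump m (toℕ x + A)) (<-≤-trans j<A (≤-trans (m≤n+m A n) (m≤n+m (n + A) (toℕ y)))))
    (trans (bump-< m (<-≤-trans j<A (m≤n+m A (toℕ x)))) (agree j j<A))
... | r′ , m′ , loop , f1 , f2 , f5 , f6 , sources , targets =
  r′ , m′ , iteration ⨾ loop
  , trans f1 e1 , f2 , f5 , f6 , sources′ , targets′
  where
  m₁ = bump m (toℕ x + A)
  rotate : ∀ a b c → a + (b + c) ≡ b + a + c
  rotate = solve-∀
  p+1<A : r 4 + 1 < A
  p+1<A = ≤-trans (m≤m+n (suc (r 4 + 1)) (length qs + length qs))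
                  (subst (_≤ A) (sym (regroup (r 4) (length qs))) len)
    where
    regroup : ∀ p l → suc (p + 1) + (l + l) ≡ p + (suc l + suc l)
    regroup = solve-∀
  p<A : r 4 < A
  p<A = ≤-<-trans (m≤m+n (r 4) 1) p+1<A
  iteration : ⟨ 8 , r , m ⟩ —⟨ 15 ⟩→ ⟨ 8 , r₁ , bump m₁ (toℕ y + (n + A)) ⟩
  iteration = jumpIf0-suc refl r3 ⨾ subst (λ m′ → ⟨ 9 , r , m ⟩ —⟨ 14 ⟩→ ⟨ 8 , r₁ , m′ ⟩)
    (bumps≡bump² m r2 r5 r6 (trans (agree _ p<A) readx) (trans (agree _ p+1<A) ready) p+1<A) body
  sources′ : ∀ z → m′ (toℕ z + A) ≡ source ((x , y) ∷ qs) z + m (toℕ z + A)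
  -- The second counter lies at `n + A` or later, past `toℕ z + A` because `toℕ z` is less than `n`;
  -- so the two blocks of counters are disjoint.
  sources′ z = trans (sources z) (trans (cong (source qs z +_) (trans
    (bump-< m₁ (<-≤-trans (+-monoˡ-< A (Fin.toℕ<n z)) (m≤n+m (n + A) (toℕ y))))
    (bump-Fin m A z x))) (rotate (source qs z) ⟦ x Fin.≟ z ⟧ (m (toℕ z + A))))
  targets′ : ∀ z → m′ (toℕ z + (n + A)) ≡ target ((x , y) ∷ qs) z + m (toℕ z + (n + A))
  targets′ z = trans (targets z) (trans (cong (target qs z +_) (trans
    (bump-Fin m₁ (n + A) z y)
    (cong (⟦ y Fin.≟ z ⟧ +_) (bump-> m (<-≤-trans (+-monoˡ-< A (Fin.toℕ<n x)) (m≤n+m (n + A) (toℕ z)))))))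
    (rotate (target qs z) ⟦ y Fin.≟ z ⟧ (m (toℕ z + (n + A)))))

-- Marks are written downwards over input cells that are no longer read, and `n ≤ A` keeps them
-- clear of the counters. The last conclusion protects marks already written by earlier rounds.
markLoop : ∀ {n} A → n ≤ A → ∀ i r m → i ≤ n → r 1 ≡ i → r 2 ≡ 1 → r 5 ≡ A → r 6 ≡ n + A →
  Σ[ r′ ∈ (ℕ → ℕ) ] Σ[ m′ ∈ (ℕ → ℕ) ]
    ⟨ 23 , r , m ⟩ —⟨ i * 10 + 1 ⟩→ ⟨ 33 , r′ , m′ ⟩
    × (∀ j → j < i → m′ j ≡ 1 ∸ (m (j + (n + A)) ∸ m (j + A)))
    × (∀ j → i ≤ j → m′ j ≡ m j)
markLoop A n≤A zero r m i≤n r1 r2 r5 r6 = r , m , jumpIf0-zero refl r1 , (λ _ ()) , (λ _ _ → refl)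
markLoop {n} A n≤A (suc i) r m i<n r1 r2 r5 r6
  with markBody r m
... | r₁ , body , e1 , e2 , e5 , e6
  with markLoop A n≤A i r₁ (m [ i ≔ 1 ∸ (m (i + (n + A)) ∸ m (i + A)) ]) (<⇒≤ i<n)
         (trans e1 (cong₂ _∸_ r1 r2)) (trans e2 r2) (trans e5 r5) (trans e6 r6)
... | r′ , m′ , loop , marked , unmarked =
  r′ , m′ , iteration ⨾ loop
  , marked′ , λ j i<j → trans (unmarked j (<⇒≤ i<j)) ([≔]-other m _ (<⇒≢ i<j))
  where
  mark : ∀ {a b c d} → a ≡ i → b ≡ 1 → c ≡ n + A → d ≡ A →
         m [ a ≔ b ∸ (m (c + a) ∸ m (d + a)) ] ≡ m [ i ≔ 1 ∸ (m (i + (n + A)) ∸ m (i + A)) ]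
  mark refl refl refl refl = cong₂ (λ s t → m [ i ≔ 1 ∸ (m s ∸ m t) ]) (+-comm (n + A) i) (+-comm A i)
  iteration : ⟨ 23 , r , m ⟩ —⟨ 10 ⟩→ ⟨ 23 , r₁ , m [ i ≔ 1 ∸ (m (i + (n + A)) ∸ m (i + A)) ] ⟩
  iteration = jumpIf0-suc refl r1 ⨾ subst (λ m′ → ⟨ 24 , r , m ⟩ —⟨ 9 ⟩→ ⟨ 23 , r₁ , m′ ⟩)
    (mark (cong₂ _∸_ r1 r2) r2 r6 r5) body
  beyond : ∀ j b → A ≤ b → (m [ i ≔ 1 ∸ (m (i + (n + A)) ∸ m (i + A)) ]) (j + b) ≡ m (j + b)
  beyond j b A≤b = [≔]-other m _ (<⇒≢ (<-≤-trans i<n (≤-trans n≤A (≤-trans A≤b (m≤n+m b j)))))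
  marked′ : ∀ j → j < suc i → m′ j ≡ 1 ∸ (m (j + (n + A)) ∸ m (j + A))
  marked′ j j<1+i with m<1+n⇒m<n∨m≡n j<1+i
  ... | inj₁ j<i  = trans (marked j j<i) (cong₂ (λ s t → 1 ∸ (s ∸ t)) (beyond j (n + A) (m≤n+m A n))
                                                                  (beyond j A ≤-refl))
  ... | inj₂ refl = trans (unmarked j ≤-refl) ([≔]-same m j _)

-- Correctness and running time on an arbitrary listing.

module _ {P : FinPoset} (L : Listing P) where
  open FinPoset P using (size; _≺?_)
  open Listing L

  private xs = allFin size

  ∑-pairs : ∀ f → ∑ pairs f ≡ ∑[ a ← xs ] ∑[ b ← xs ] ⟦ a ≺? b ⟧ * f (a , b)
  ∑-pairs f = begin
    ∑ pairs f
      ≡⟨ ∑-↭ f pairs-↭ ⟩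
    ∑ (E P ⊤ ⊤) f
      ≡⟨ trans (∑-filter (λ (a , b) → related? a b) f (cartesianProduct xs xs))
               (∑-cartesianProduct (λ (a , b) → ⟦ related? a b ⟧ * f (a , b)) xs xs) ⟩
    ∑[ a ← xs ] ∑[ b ← xs ] ⟦ related? a b ⟧ * f (a , b)
      ≡⟨ ∑-cong xs (λ a → ∑-cong xs (λ b → cong (_* f (a , b))
           (⟦⟧-cong (related? a b) (a ≺? b) (λ (_ , _ , a≺b) → a≺b) (λ a≺b → ∈⊤ , ∈⊤ , a≺b)))) ⟩
    ∑[ a ← xs ] ∑[ b ← xs ] ⟦ a ≺? b ⟧ * f (a , b)
      ∎
    where
    open ≡-Reasoning
    related? : (a b : Fin size) → Dec _
    related? a b = (a ∈? ⊤) ×-dec (b ∈? ⊤) ×-dec (a ≺? b)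

  target-pairs : ∀ x → target pairs x ≡ down P x
  target-pairs x = trans (∑-pairs (λ (_ , b) → ⟦ b Fin.≟ x ⟧))
    (∑-cong xs (λ a → trans (∑-cong xs (λ b → *-comm ⟦ a ≺? b ⟧ ⟦ b Fin.≟ x ⟧)) (∑-δ x (λ b → ⟦ a ≺? b ⟧))))

  source-pairs : ∀ x → source pairs x ≡ up P x
  source-pairs x = trans (∑-pairs (λ (a , _) → ⟦ a Fin.≟ x ⟧))
    (trans (∑-swap (λ a b → ⟦ a ≺? b ⟧ * ⟦ a Fin.≟ x ⟧) xs xs)
    (∑-cong xs (λ b → trans (∑-cong xs (λ a → *-comm ⟦ a ≺? b ⟧ ⟦ a Fin.≟ x ⟧)) (∑-δ x (λ a → ⟦ a ≺? b ⟧)))))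

  private
    l = length elements
    k = length pairs
    A = 2 + l + k + k

  l≡size : l ≡ size
  l≡size = trans (↭-length elements-↭) (length-tabulate id)

  size≤A : size ≤ A
  size≤A = subst (_≤ A) l≡size (≤-trans (m≤n+m l 2) (≤-trans (m≤m+n (2 + l) k) (m≤m+n (2 + l + k) k)))

  reads : Reads (memory (encode L)) (2 + l) pairs
  reads = subst (λ p → Reads (memory (encode L)) (2 + p) pairs) (length-map toℕ elements)
                (Reads-flatten (l ∷ k ∷ map toℕ elements) pairs)

  length-encode : length (encode L) ≡ A
  length-encode = cong (2 +_) (trans (length-++ (map toℕ elements))
    (trans (cong₂ _+_ (length-map toℕ elements) (length-flatten pairs)) (sym (+-assoc l k k))))

  blank : ∀ {a} → A ≤ a → memory (encode L) a ≡ 0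
  blank A≤a = memory-beyond (encode L) (≤-trans (≤-reflexive length-encode) A≤a)

  cutProgram-correct : ∃[ t ] t ≤ 15 * (1 + inputSize P)
                       × Halted cutProgram (run cutProgram t (start (encode L)))
                       × Outputs (run cutProgram t (start (encode L))) (balancedCut P)
  cutProgram-correct with setup (memory (encode L))
  ... | r , setting-up , r1 , r2 , r3 , r4 , r5 , r6
    with pairLoop A (memory (encode L)) pairs (2 + l) r (memory (encode L)) r2 r3 r4 r5
           (trans r6 (trans (cong (A +_) l≡size) (+-comm A size))) reads
           (≤-reflexive (sym (+-assoc (2 + l) k k))) (λ _ _ → refl)
  ... | r′ , m′ , counting , r′1 , r′2 , r′5 , r′6 , sources , targets
    with markLoop A size≤A size r′ m′ ≤-refl (trans r′1 (trans r1 l≡size)) r′2 r′5 r′6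
  ... | r″ , m″ , marking , marked , _ = t , t≤ , halted , outputs
    where
    t = 8 + (k * 15 + 1 + (size * 10 + 1))
    run≡ : run cutProgram t (start (encode L)) ≡ ⟨ 33 , r″ , m″ ⟩
    run≡ = _—⟨_⟩→_.run≡ (setting-up ⨾ (counting ⨾ marking))
    t≤ : t ≤ 15 * (1 + inputSize P)
    -- The running time is 15k + 10|P| + 10, and the slack 5 + 5|P| completes it to 15(1 + |P| + k).
    t≤ = ≤-trans (m≤m+n t (5 + size * 5)) (≤-reflexive
      (trans (total k size) (cong (λ e → 15 * (1 + (size + e))) (↭-length pairs-↭))))
      where
      total : ∀ k n → 8 + (k * 15 + 1 + (n * 10 + 1)) + (5 + n * 5) ≡ 15 * (1 + (n + k))
      total = solve-∀
    halted : Halted cutProgram (run cutProgram t (start (encode L)))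
    halted = subst (Halted cutProgram) (sym run≡) refl
    value : ∀ x → m″ (toℕ x) ≡ 1 ∸ (down P x ∸ up P x)
    value x = trans (marked (toℕ x) (Fin.toℕ<n x)) (cong₂ (λ d u → 1 ∸ (d ∸ u))
      (trans (targets x) (trans (cong₂ _+_ (target-pairs x)
        (blank (≤-trans (m≤n+m A size) (m≤n+m (size + A) (toℕ x))))) (+-identityʳ _)))
      (trans (sources x) (trans (cong₂ _+_ (source-pairs x) (blank (m≤n+m A (toℕ x)))) (+-identityʳ _))))
    outputs : Outputs (run cutProgram t (start (encode L))) (balancedCut P)
    outputs rewrite run≡ = λ x →
      (λ x∈B → trans (value x) (cong (1 ∸_) (m≤n⇒m∸n≡0 (∈-fromDec⁻ (down≤up? P) x∈B)))) ,
      -- On `U` the difference of the degrees is at least 1, so the truncated 1 ∸ (down ∸ up) is 0.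
      (λ x∈U → trans (value x) (m≤n⇒m∸n≡0 (m<n⇒0<n∸m (≰⇒> (x∈∁p⇒x∉p x∈U ∘ ∈-fromDec⁺ (down≤up? P))))))

theorem1p1 : (∀ (P : FinPoset) → Σ[ C ∈ Cut P ] ePP P ≤ 2 * cutSize P C)
    × (Σ[ P ∈ (ℕ → FinPoset) ] Σ[ maxCut ∈ (ℕ → ℕ) ] Σ[ ε ∈ (ℕ → ℚ) ]
    TendsToInfinity (λ n → ePP (P n))
    × (∀ n → IsMaxCutSize (P n) (maxCut n))
    × TendsToZero ε
    × (∀ n → fromℕ (maxCut n) ≡ ((1ℚ ℚ.+ ε n) ℚ.* ½) ℚ.* fromℕ (ePP (P n))))
    × (∃[ prog ] FindsCutInLinearTime (λ P C → ePP P ≤ 2 * cutSize P C) prog)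
theorem1p1 =
    (λ P → balancedCut P , ePP≤2*balancedCut P)
  -- Chains of 2k elements with k = n + 1: the shift turns 2k - 1 into 2n + 1, which is positive
  -- from the start.
  , ( (λ n → chain (suc n + suc n)) , (λ n → suc n * suc n) , 1/odd , ePP→∞
    , (λ n → (halfCut (suc n) , cutSize-halfCut (suc n)) , λ C → cutSize≤ (chain (suc n + suc n)) C refl)
    , 1/odd→0
    , λ n → trans (tight-ratio n)
        (cong (λ e → ((1ℚ ℚ.+ 1/odd n) ℚ.* ½) ℚ.* fromℕ e) (sym (ePP-even-chain n))) )
  , (cutProgram , 15 , λ P L → let t , t≤ , halted , outputs = cutProgram-correct L in
      t , t≤ , halted , balancedCut P , outputs , ePP≤2*balancedCut P)
  where
  ePP→∞ : TendsToInfinity (λ n → ePP (chain (suc n + suc n)))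
  ePP→∞ K = K , λ n K≤n → ≤-trans K≤n (≤-trans (n≤1+n n)
    (≤-trans (m≤m*n (suc n) (suc (2 * n))) (≤-reflexive (sym (ePP-even-chain n)))))
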